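{- Let $\mathcal{F}$ be any class of frames. Then the following are equivalent: (1) for every finite set $\mathrm{Prop}$ of propositional variables, the concept class $\mathbb{C}(\mathcal{F},\mathcal{L}_{\mathrm{full}}[\mathrm{Prop}])$ admits finite characterisations; (2) the modal logic of $\mathcal{F}$ is locally tabular.
   Context: $\mathcal{L}_{\mathrm{full}}[\mathrm{Prop}]$ is the set of all modal formulas generated by $\varphi::=\top\mid\bot\mid p\mid\neg p\mid(\varphi\wedge\varphi)\mid(\varphi\vee\varphi)\mid\Diamond\varphi\mid\Box\varphi$ with $p\in\mathrm{Prop}$. A Kripke model over $\mathrm{Prop}$ is $M=(dom(M),R,v)$ with $R\subseteq dom(M)\times dom(M)$ and $v:dom(M)\to\mathcal{P}(\mathrm{Prop})$; its frame is $(dom(M),R)$; a pointed model is a pair $(M,s)$ with $s\in dom(M)$. Satisfaction is the standard Kripke semantics. The modal logic of $\mathcal{F}$ is locally tabular if for every finite set $\mathrm{Prop}$ there are only finitely many modal formulas over $\mathrm{Prop}$ up to equivalence over $\mathcal{F}$, where $\varphi,\psi$ are equivalent over $\mathcal{F}$ if they are satisfied by the same pointed models whose frame is in $\mathcal{F}$. $\mathbb{C}(\mathcal{F},\mathcal{L}_{\mathrm{full}}[\mathrm{Prop}])$ is the concept class whose examples are the pointed models over $\mathrm{Prop}$ whose frame is in $\mathcal{F}$, whose concepts are the formulas in $\mathcal{L}_{\mathrm{full}}[\mathrm{Prop}]$, and in which an example $(M,s)$ is positive for $\varphi$ if $M,s\models\varphi$ and negative otherwise. A formula $\varphi$ fits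 a pair $(E^+,E^-)$ of finite sets of examples if every element of $E^+$ is a positive example and every element of $E^-$ is a negative example for $\varphi$. A finite characterisation of $\varphi$ is a pair $(E^+,E^-)$ of finite sets of examples such that $\varphi$ fits $(E^+,E^-)$ and every formula of the class that fits $(E^+,E^-)$ has the same positive examples as $\varphi$. The concept class admits finite characterisations if each of its formulas has one. -}

module Defs where

open import Data.Empty.Polymorphic using (⊥)
open import Data.Fin using (Fin)
open import Data.List using (List)
open import Data.List.Relation.Unary.All using (All)
open import Data.List.Relation.Unary.Any using (Any)
open import Data.Product using (Σ; Σ-syntax; ∃-syntax; _×_; _,_; proj₁)
open import Data.Sum using (_⊎_)
open import Data.Unit.Polymorphic using (⊤)
open import Function.Bundles using (_⇔_; _↔_)
open import Level using (Level; _⊔_; suc; 0ℓ)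
open import Relation.Binary.Core using (Rel)
open import Relation.Nullary using (¬_)
open import Relation.Unary using (Pred)

Finite : ∀ {a} → Set a → Set a
Finite A = ∃[ n ] (A ↔ Fin n)

infixr 7 _∧′_
infixr 6 _∨′_
infix  9 ◇_ □_

data Formula (P : Set) : Set where
  ⊤′ ⊥′     : Formula P
  pos neg   : P → Formula P
  _∧′_ _∨′_ : Formula P → Formula P → Formula P
  ◇_ □_     : Formula P → Formula P

record Frame (ℓ : Level) : Set (suc ℓ) where
  field
    dom : Set ℓ
    R   : Rel dom ℓ

-- An arbitrary predicate: no closure condition, not even under isomorphism.
FrameClass : (ℓ f : Level) → Set (suc ℓ ⊔ suc f)
FrameClass ℓ f = Pred (Frame ℓ) f

record Model (ℓ : Level) (P : Set) : Set (suc ℓ) where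
  field
    frame : Frame ℓ
  open Frame frame public
  field
    v : dom → Pred P ℓ

record PointedModel (ℓ : Level) (P : Set) : Set (suc ℓ) where
  constructor _,ₚ_
  field
    model : Model ℓ P
    point : Model.dom model
  open Model model public

infix 4 _,_⊨_

_,_⊨_ : ∀ {ℓ P} (M : Model ℓ P) → Model.dom M → Formula P → Set ℓ
M , s ⊨ ⊤′       = ⊤
M , s ⊨ ⊥′       = ⊥
M , s ⊨ pos p    = Model.v M s p
M , s ⊨ neg p    = ¬ Model.v M s p
M , s ⊨ φ ∧′ ψ   = (M , s ⊨ φ) × (M , s ⊨ ψ)
M , s ⊨ φ ∨′ ψ   = (M , s ⊨ φ) ⊎ (M , s ⊨ ψ)
M , s ⊨ ◇ φ      = ∃[ t ] (Model.R M s t × (M , t ⊨ φ))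
M , s ⊨ □ φ      = ∀ t → Model.R M s t → M , t ⊨ φ

EquivalentOver : ∀ {ℓ f} → FrameClass ℓ f → {P : Set} →
                 Formula P → Formula P → Set (suc ℓ ⊔ f)
EquivalentOver {ℓ} F {P} φ ψ =
  (M : Model ℓ P) → F (Model.frame M) →
  (s : Model.dom M) → (M , s ⊨ φ) ⇔ (M , s ⊨ ψ)

LocallyTabular : ∀ {ℓ f} → FrameClass ℓ f → Set (suc ℓ ⊔ f)
LocallyTabular F =
  (P : Set) → Finite P →
  Σ[ φs ∈ List (Formula P) ] ((ψ : Formula P) → Any (EquivalentOver F ψ) φs)

record ConceptClass (e c r : Level) : Set (suc (e ⊔ c ⊔ r)) where
  field
    Example    : Set e
    Concept    : Set c
    IsPositive : Concept → Example → Set r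

  IsNegative : Concept → Example → Set r
  IsNegative φ x = ¬ IsPositive φ x

  -- Finite sets of examples are given by lists enumerating them.
  Fits : Concept → List Example × List Example → Set (e ⊔ r)
  Fits φ (E⁺ , E⁻) = All (IsPositive φ) E⁺ × All (IsNegative φ) E⁻

  SamePositives : Concept → Concept → Set (e ⊔ r)
  SamePositives φ ψ = (x : Example) → IsPositive φ x ⇔ IsPositive ψ x

  IsFiniteCharacterisation : Concept → List Example × List Example → Set (e ⊔ c ⊔ r)
  IsFiniteCharacterisation φ E =
    Fits φ E × ((ψ : Concept) → Fits ψ E → SamePositives ψ φ)

  AdmitsFiniteCharacterisations : Set (e ⊔ c ⊔ r)
  AdmitsFiniteCharacterisations =
    (φ : Concept) → ∃[ E ] IsFiniteCharacterisation φ E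

open ConceptClass public using (AdmitsFiniteCharacterisations)

ℂ : ∀ {ℓ f} → FrameClass ℓ f → (P : Set) → ConceptClass (suc ℓ ⊔ f) 0ℓ ℓ
ℂ {ℓ} F P = record
  { Example    = Σ[ x ∈ PointedModel ℓ P ] F (PointedModel.frame x)
  ; Concept    = Formula P
  ; IsPositive = λ φ x → PointedModel.model (proj₁ x) , PointedModel.point (proj₁ x) ⊨ φ
  }

{-# OPTIONS --safe #-}

-- For (1) ⇒ (2), a characterisation of ⊤′ alone suffices: a formula true on its finitely many
-- positive examples is valid over F, and applied to biconditionals this says that two formulas
-- agreeing on n examples are equivalent, so there are at most 2ⁿ formulas up to equivalence.
-- Conversely, φ is characterised by choosing, for each of the finitely many representatives not
-- equivalent to φ, one example on which it differs from φ.
module Submission where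

open import Defs
open import Axiom.ExcludedMiddle using (ExcludedMiddle)
open import Data.Empty.Polymorphic using (⊥-elim)
open import Data.List using (List; []; _∷_; _++_)
open import Data.List.Relation.Unary.All as All using (All; []; _∷_)
open import Data.List.Relation.Unary.All.Properties using () renaming (++⁺ to All-++⁺; ++⁻ to All-++⁻)
open import Data.List.Relation.Unary.Any as Any using (Any; here; there)
open import Data.List.Relation.Unary.Any.Properties using (++⁺ˡ; ++⁺ʳ)
open import Data.Product using (Σ-syntax; ∃-syntax; _×_; _,_; proj₁; proj₂)
open import Data.Sum using (inj₁; inj₂)
open import Data.Unit.Polymorphic using (⊤; tt)
open import Function using (const; _∘_)
open import Function.Bundles using (_⇔_; mk⇔; Equivalence)
open import Function.Construct.Composition using (_⇔-∘_)
open import Level using (Level; _⊔_; suc; Lift; lift; lower)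
open import Relation.Nullary using (¬_; yes; no; contradiction)
open import Relation.Nullary.Decidable using (map′; decidable-stable)
open import Relation.Unary using (Pred; _∩_; ∁)

open Equivalence using (to; from)

private variable
  ℓ f a e c r : Level
  P : Set

lower-em : ∀ b → ExcludedMiddle (a ⊔ b) → ExcludedMiddle a
lower-em b em {A} = map′ lower lift (em {Lift b A})

module _ {A : Set a} {X : Set e} (_⊩_ : A → X → Set r) where

  Agree : List X → A → A → Set (e ⊔ r)
  Agree xs b a = All (λ x → b ⊩ x ⇔ a ⊩ x) xs

  -- `Q` accumulates the outcomes on the examples already treated: each example splits it in two,
  -- and at the end of the list one witness of `Q` is chosen if any exists. Each pattern of outcomes
  -- thus contributes at most one representative.
  agreementRepresentatives : ExcludedMiddle (a ⊔ r) → (xs : List X) (Q : Pred A r) →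
    Σ[ as ∈ List A ] (∀ {b} → Q b → Any (Q ∩ Agree xs b) as)
  agreementRepresentatives em [] Q with em {∃[ a ] Q a}
  ... | yes (a , q) = a ∷ [] , λ _ → here (q , [])
  ... | no  ∄q      = [] , λ q → contradiction (_ , q) ∄q
  agreementRepresentatives em (x ∷ xs) Q
    with agreementRepresentatives em xs (Q ∩ (_⊩ x)) | agreementRepresentatives em xs (Q ∩ ∁ (_⊩ x))
  ... | as⁺ , rep⁺ | as⁻ , rep⁻ = as⁺ ++ as⁻ , rep
    where
    rep : ∀ {b} → Q b → Any (Q ∩ Agree (x ∷ xs) b) (as⁺ ++ as⁻)
    rep {b} q with lower-em a em {b ⊩ x}
    ... | yes p = ++⁺ˡ (Any.map (λ ((q′ , p′) , h) → q′ , mk⇔ (const p′) (const p) ∷ h) (rep⁺ (q , p)))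
    ... | no ¬p = ++⁺ʳ as⁺ (Any.map
      (λ ((q′ , ¬p′) , h) → q′ , mk⇔ (λ p → contradiction p ¬p) (λ p′ → contradiction p′ ¬p′) ∷ h)
      (rep⁻ (q , ¬p)))

module _ (C : ConceptClass e c r) (em : ExcludedMiddle (e ⊔ r)) where
  open ConceptClass C hiding (AdmitsFiniteCharacterisations)

  private
    decide : ExcludedMiddle r
    decide = lower-em e em

  Fits-resp-SamePositives : ∀ {φ ψ} → SamePositives φ ψ → ∀ {E} → Fits φ E → Fits ψ E
  Fits-resp-SamePositives φ≈ψ (ps , ns) =
    All.map (λ {x} → to (φ≈ψ x)) ps , All.map (λ {x} ¬p → ¬p ∘ from (φ≈ψ x)) ns

  -- The uniqueness clause of `IsFiniteCharacterisation` for a single competitor, so that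
  -- competitors can be handled one at a time.
  CharacterisesAgainst : Concept → List Example × List Example → Concept → Set (e ⊔ r)
  CharacterisesAgainst φ E χ = Fits χ E → SamePositives χ φ

  separate : ∀ φ χ → ∃[ E ] (Fits φ E × CharacterisesAgainst φ E χ)
  separate φ χ with em {∃[ x ] (IsPositive φ x × IsNegative χ x)}
  ... | yes (x , p , ¬q) = (x ∷ [] , []) , (p ∷ [] , []) , λ { (q ∷ [] , []) → contradiction q ¬q }
  ... | no φ⊆χ with em {∃[ x ] (IsNegative φ x × IsPositive χ x)}
  ...   | yes (x , ¬p , q) = ([] , x ∷ []) , ([] , ¬p ∷ []) , λ { ([] , ¬q ∷ []) → contradiction q ¬q }
  -- No example tells the two apart in either direction, so the conclusion holds whatever the fit,
  -- and the empty pair suffices.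
  ...   | no χ⊆φ = ([] , []) , ([] , []) , λ _ x → mk⇔
          (λ q → decidable-stable decide λ ¬p → χ⊆φ (x , ¬p , q))
          (λ p → decidable-stable decide λ ¬q → φ⊆χ (x , p , ¬q))

  -- Separations survive concatenation, because fitting the enlarged pair entails fitting each of
  -- its pieces.
  separateAll : ∀ φ χs → ∃[ E ] (Fits φ E × All (CharacterisesAgainst φ E) χs)
  separateAll φ [] = ([] , []) , ([] , []) , []
  separateAll φ (χ ∷ χs) with separate φ χ | separateAll φ χs
  ... | (E⁺ , E⁻) , (ps , ns) , sep | (D⁺ , D⁻) , (ps′ , ns′) , seps =
    (E⁺ ++ D⁺ , E⁻ ++ D⁻) , (All-++⁺ ps ps′ , All-++⁺ ns ns′) ,
    (λ (p , n) → sep (proj₁ (All-++⁻ E⁺ p) , proj₁ (All-++⁻ E⁻ n))) ∷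
    All.map (λ s (p , n) → s (proj₂ (All-++⁻ E⁺ p) , proj₂ (All-++⁻ E⁻ n))) seps

  finitelyManyConcepts⇒finiteCharacterisations : (χs : List Concept) →
    (∀ ψ → Any (SamePositives ψ) χs) → AdmitsFiniteCharacterisations C
  finitelyManyConcepts⇒finiteCharacterisations χs rep φ with separateAll φ χs
  ... | E , fits , seps = E , fits , λ ψ → unique (rep ψ) seps
    where
    unique : ∀ {ψ χs} → Any (SamePositives ψ) χs → All (CharacterisesAgainst φ E) χs →
             Fits ψ E → SamePositives ψ φ
    -- Fitting depends only on the positive examples, so the representative of `ψ` fits as well and
    -- hence agrees with `φ`.
    unique (here ψ≈χ) (sep ∷ _) fit x =
      sep (Fits-resp-SamePositives ψ≈χ fit) x ⇔-∘ ψ≈χ x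
    unique (there i) (_ ∷ seps) fit = unique i seps fit

infix 9 ¬′_
infix 5 _⇔′_

-- Formulas are in negation normal form, so negation is computed by dualising.
¬′_ : Formula P → Formula P
¬′ ⊤′       = ⊥′
¬′ ⊥′       = ⊤′
¬′ pos p    = neg p
¬′ neg p    = pos p
¬′ (φ ∧′ ψ) = ¬′ φ ∨′ ¬′ ψ
¬′ (φ ∨′ ψ) = ¬′ φ ∧′ ¬′ ψ
¬′ (◇ φ)    = □ ¬′ φ
¬′ (□ φ)    = ◇ ¬′ φ

_⇔′_ : Formula P → Formula P → Formula P
φ ⇔′ ψ = φ ∧′ ψ ∨′ ¬′ φ ∧′ ¬′ ψ

module _ (M : Model ℓ P) where

  ⊨-¬′⇒⊭ : ∀ {s} φ → M , s ⊨ ¬′ φ → ¬ (M , s ⊨ φ)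
  ⊨-¬′⇒⊭ ⊤′       n         _           = ⊥-elim n
  ⊨-¬′⇒⊭ ⊥′       _         h           = ⊥-elim h
  ⊨-¬′⇒⊭ (pos p)  n         h           = n h
  ⊨-¬′⇒⊭ (neg p)  n         h           = h n
  ⊨-¬′⇒⊭ (φ ∧′ ψ) (inj₁ n)  (h , _)     = ⊨-¬′⇒⊭ φ n h
  ⊨-¬′⇒⊭ (φ ∧′ ψ) (inj₂ n)  (_ , h)     = ⊨-¬′⇒⊭ ψ n h
  ⊨-¬′⇒⊭ (φ ∨′ ψ) (n , _)   (inj₁ h)    = ⊨-¬′⇒⊭ φ n h
  ⊨-¬′⇒⊭ (φ ∨′ ψ) (_ , n)   (inj₂ h)    = ⊨-¬′⇒⊭ ψ n h
  ⊨-¬′⇒⊭ (◇ φ)    n         (t , r , h) = ⊨-¬′⇒⊭ φ (n t r) h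
  ⊨-¬′⇒⊭ (□ φ)    (t , r , n) h         = ⊨-¬′⇒⊭ φ n (h t r)

  ⊨-⇔′⇒⇔ : ∀ {s} φ ψ → M , s ⊨ (φ ⇔′ ψ) → (M , s ⊨ φ) ⇔ (M , s ⊨ ψ)
  ⊨-⇔′⇒⇔ φ ψ (inj₁ (p , q)) = mk⇔ (const q) (const p)
  ⊨-⇔′⇒⇔ φ ψ (inj₂ (m , n)) =
    mk⇔ (λ p → contradiction p (⊨-¬′⇒⊭ φ m)) (λ q → contradiction q (⊨-¬′⇒⊭ ψ n))

  module _ (em : ExcludedMiddle ℓ) where

    -- The classical half of the correctness of `¬′_`: excluded middle enters at negated variables,
    -- conjunctions and boxes.
    ⊭⇒⊨-¬′ : ∀ {s} φ → ¬ (M , s ⊨ φ) → M , s ⊨ ¬′ φ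
    ⊭⇒⊨-¬′ ⊤′      n = contradiction tt n
    ⊭⇒⊨-¬′ ⊥′      n = tt
    ⊭⇒⊨-¬′ (pos p) n = n
    ⊭⇒⊨-¬′ (neg p) n = decidable-stable em n
    ⊭⇒⊨-¬′ {s} (φ ∧′ ψ) n with em {M , s ⊨ φ}
    ... | yes p = inj₂ (⊭⇒⊨-¬′ ψ λ q → n (p , q))
    ... | no ¬p = inj₁ (⊭⇒⊨-¬′ φ ¬p)
    ⊭⇒⊨-¬′ (φ ∨′ ψ) n = ⊭⇒⊨-¬′ φ (n ∘ inj₁) , ⊭⇒⊨-¬′ ψ (n ∘ inj₂)
    ⊭⇒⊨-¬′ (◇ φ)    n = λ t r → ⊭⇒⊨-¬′ φ λ h → n (t , r , h)
    -- If no successor satisfied `¬′ φ`, then every successor would satisfy `φ`, against `n`.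
    ⊭⇒⊨-¬′ (□ φ)    n = decidable-stable em λ ∄t →
      n λ t r → decidable-stable em λ ¬h → ∄t (t , r , ⊭⇒⊨-¬′ φ ¬h)

    ⇔⇒⊨-⇔′ : ∀ {s} φ ψ → (M , s ⊨ φ) ⇔ (M , s ⊨ ψ) → M , s ⊨ (φ ⇔′ ψ)
    ⇔⇒⊨-⇔′ {s} φ ψ φ⇔ψ with em {M , s ⊨ φ}
    ... | yes p = inj₁ (p , to φ⇔ψ p)
    ... | no ¬p = inj₂ (⊭⇒⊨-¬′ φ ¬p , ⊭⇒⊨-¬′ ψ (¬p ∘ from φ⇔ψ))

module _ (F : FrameClass ℓ f) where
  open ConceptClass

  EquivalentOver⇒SamePositives : (φ ψ : Formula P) →
    EquivalentOver F φ ψ → SamePositives (ℂ F P) φ ψ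
  EquivalentOver⇒SamePositives _ _ φ≈ψ ((M ,ₚ s) , M∈F) = φ≈ψ M M∈F s

  characterisation-⊤′⇒finitelyManyFormulas : ExcludedMiddle ℓ →
    ∃[ E ] IsFiniteCharacterisation (ℂ F P) ⊤′ E →
    Σ[ φs ∈ List (Formula P) ] (∀ ψ → Any (EquivalentOver F ψ) φs)
  characterisation-⊤′⇒finitelyManyFormulas {P = P} em ((E⁺ , E⁻) , (_ , ns) , unique) =
    proj₁ reps , λ ψ → Any.map (λ {φ} (_ , agree) → equivalent ψ φ agree) (proj₂ reps {ψ} tt)
    where
    reps = agreementRepresentatives (IsPositive (ℂ F P)) em E⁺ (const ⊤)

    equivalent : ∀ ψ φ → Agree (IsPositive (ℂ F P)) E⁺ ψ φ → EquivalentOver F ψ φ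
    equivalent ψ φ agree M M∈F s = ⊨-⇔′⇒⇔ M ψ φ (from (valid ((M ,ₚ s) , M∈F)) tt)
      where
      valid : SamePositives (ℂ F P) (ψ ⇔′ φ) ⊤′
      valid = unique (ψ ⇔′ φ)
        -- Agreement on `E⁺` is truth of the biconditional there.
        ( All.map (λ {((N ,ₚ t) , _)} → ⇔⇒⊨-⇔′ N em ψ φ) agree
        -- Since `⊤′` fits the pair, a member of `E⁻` would have to refute `⊤′`; so the negative
        -- side is vacuous.
        , All.map (contradiction tt) ns )

theorem3p7 : ∀ {ℓ f : Level} → ExcludedMiddle (suc ℓ ⊔ f) →
    (F : FrameClass ℓ f) →
    ((P : Set) → Finite P → AdmitsFiniteCharacterisations (ℂ F P)) ⇔ LocallyTabular F
theorem3p7 {ℓ} {f} em F = mk⇔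
  (λ char P fin → characterisation-⊤′⇒finitelyManyFormulas F (lower-em (suc ℓ ⊔ f) em) (char P fin ⊤′))
  (λ tab P fin → let φs , rep = tab P fin in
    finitelyManyConcepts⇒finiteCharacterisations (ℂ F P) em φs
      (λ ψ → Any.map (λ {φ} → EquivalentOver⇒SamePositives F ψ φ) (rep ψ)))
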